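{- Let $k$ and $n$ be natural numbers. Then $$A_k(n)=\tfrac12 D_k(n+1),$$ where $A_k(n):=\tfrac12\big(P_1(d,n)+P'_{k-1}(d,n)+P_2(d,n)+P''_{k-1}(d,n)\big)$.
   Context: The partition functions are defined as follows. - $P_1(d,n)$ is the number of partitions of $n$ into distinct parts whose smallest part exceeds $1$. - $P_2(d,n)$ is the number of partitions of $n$ into distinct parts for which the difference between the two smallest parts is at least $2$ (a partition with a single part counts vacuously). - $P'_{k-1}(d,n)$ is the number of partitions of $n$ in which all parts are distinct except that the smallest part is $1$ with multiplicity $k-1$. - $P''_{k-1}(d,n)$ is the number of partitions of $n$ into distinct parts except that the second smallest part appears with multiplicity $k-1$, where the difference between the two smallest parts is $1$. - $D_k(n)$ is the number of partitions of $n$ into non-negative parts (the part $0$ allowed) in which the smallest part appears exactly $k$ times and no other part is repeated, with $D_k(0)=1$. Its generating function is $\sum_{n\ge0}D_k(n)q^n=\sum_{m\ge0}q^{mk}(-q^{m+1};q)_\infty$. -}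

module Defs where

open import Data.Empty using (⊥)
open import Data.Integer using (+_)
open import Data.List
  using (List; []; _∷_; [_]; length; filter; head; upTo; cartesianProductWith)
open import Data.List.Membership.Propositional using (_∈_)
open import Data.List.Membership.Propositional.Properties
  using (∈-cartesianProductWith⁺; ∈-cartesianProductWith⁻; ∈-upTo⁺)
open import Data.List.Properties using (∷-injective; filter-none)
open import Data.List.Relation.Unary.All as All using (All; []; _∷_; all?)
open import Data.List.Relation.Unary.Any using (here; there)
open import Data.List.Relation.Unary.AllPairs using ([]; _∷_)
open import Data.List.Relation.Unary.Linked using (Linked; []; [-]; _∷_; linked?)
open import Data.List.Relation.Unary.Unique.DecPropositional using (unique?)
open import Data.List.Relation.Unary.Unique.Propositional using (Unique)
import Data.List.Relation.Unary.Unique.Propositional.Properties as Unique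
import Data.Maybe.Relation.Unary.All as Maybe
open import Data.Nat
  using (ℕ; zero; suc; _+_; _∸_; _≤_; _<_; z≤n; s≤s; _≟_; _≤?_; _<?_)
open import Data.Nat.ListAction using (sum)
open import Data.Nat.Properties
  using (≤-reflexive; ≤-trans; m≤m+n; m≤n+m; +-suc; +-monoˡ-≤; +-monoʳ-≤; module ≤-Reasoning)
open import Data.Product using (_×_; _,_)
open import Data.Rational as ℚ using (ℚ; ½)
open import Data.Unit using (⊤; tt)
open import Relation.Binary.PropositionalEquality
  using (_≡_; _≢_; refl; sym; cong; subst)
open import Relation.Nullary using (yes; no)
open import Relation.Nullary.Decidable using (_×-dec_; ¬?)
open import Relation.Unary using (Decidable)

fromℕ : ℕ → ℚ
fromℕ m = + m ℚ./ 1

-- A partition is the list of its parts in weakly increasing order, so the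
-- smallest part is the head of the list.  Part 0 is allowed here.

record WeakPartition (n : ℕ) (p : List ℕ) : Set where
  constructor weakPartition
  field
    sorted : Linked _≤_ p
    sums   : sum p ≡ n

Positive : List ℕ → Set
Positive = All (1 ≤_)

Distinct : List ℕ → Set
Distinct = Unique

mult : ℕ → List ℕ → ℕ
mult a p = length (filter (a ≟_) p)

DistinctExcept : ℕ → List ℕ → Set
DistinctExcept a p = Distinct (filter (λ b → ¬? (a ≟ b)) p)

weakPartition? : ∀ n → Decidable (WeakPartition n)
weakPartition? n p with linked? _≤?_ p | sum p ≟ n
... | yes s | yes e = yes (weakPartition s e)
... | no ¬s | _     = no λ w → ¬s (WeakPartition.sorted w)
... | yes _ | no ¬e = no λ w → ¬e (WeakPartition.sums w)

positive? : Decidable Positive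
positive? = all? (1 ≤?_)

distinct? : Decidable Distinct
distinct? = unique? _≟_

distinctExcept? : ∀ a → Decidable (DistinctExcept a)
distinctExcept? a p = distinct? (filter (λ b → ¬? (a ≟ b)) p)

-- All lists of length at most L over the given alphabet, each once.

words : List ℕ → ℕ → List (List ℕ)
words as zero    = [ [] ]
words as (suc L) = [] ∷ cartesianProductWith _∷_ as (words as L)

-- The number of p with P p, all of whose entries are at most n and whose
-- length is at most L.  With the values of L used below these bounds exclude
-- nothing: see the completeness lemmas at the end.

number : ∀ {P : List ℕ → Set} → Decidable P → (L n : ℕ) → ℕ
number P? L n = length (filter P? (words (upTo (suc n)) L))

Partition : ℕ → List ℕ → Set
Partition n p = WeakPartition n p × Positive p

partition? : ∀ n → Decidable (Partition n)
partition? n p = weakPartition? n p ×-dec positive? p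

-- The empty partition of 0 satisfies the condition of P₁ vacuously.

SmallestExceeds1 : List ℕ → Set
SmallestExceeds1 p = Maybe.All (1 <_) (head p)

IsP₁ : ℕ → List ℕ → Set
IsP₁ n p = Partition n p × Distinct p × SmallestExceeds1 p

isP₁? : ∀ n → Decidable (IsP₁ n)
isP₁? n p = partition? n p ×-dec distinct? p ×-dec Maybe.dec (1 <?_) (head p)

P₁ : ℕ → ℕ
P₁ n = number (isP₁? n) n n

-- Only used for distinct parts, where the first two entries are the two
-- smallest parts.  A single part qualifies vacuously; the empty partition
-- has no smallest part and is not counted.

Gap≥2 : List ℕ → Set
Gap≥2 []          = ⊥
Gap≥2 (_ ∷ [])    = ⊤
Gap≥2 (a ∷ b ∷ _) = 2 ≤ b ∸ a

gap≥2? : Decidable Gap≥2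
gap≥2? []          = no λ ()
gap≥2? (_ ∷ [])    = yes tt
gap≥2? (a ∷ b ∷ _) = 2 ≤? b ∸ a

IsP₂ : ℕ → List ℕ → Set
IsP₂ n p = Partition n p × Distinct p × Gap≥2 p

isP₂? : ∀ n → Decidable (IsP₂ n)
isP₂? n p = partition? n p ×-dec distinct? p ×-dec gap≥2? p

P₂ : ℕ → ℕ
P₂ n = number (isP₂? n) n n

-- P′ j n is P'_j(d,n), with j = k - 1.  If j ≥ 1 then 1 occurs, hence is the
-- smallest part.  If j = 0 the part 1 has multiplicity 0, i.e. does not occur;
-- in all cases the generating function is q^j (-q²;q)_∞.

IsP′ : ℕ → ℕ → List ℕ → Set
IsP′ j n p = Partition n p × mult 1 p ≡ j × DistinctExcept 1 p

isP′? : ∀ j n → Decidable (IsP′ j n)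
isP′? j n p = partition? n p ×-dec mult 1 p ≟ j ×-dec distinctExcept? 1 p

P′ : ℕ → ℕ → ℕ
P′ j n = number (isP′? j n) n n

-- P″ j n is P''_j(d,n), with j = k - 1.  The smallest part is some a, which
-- occurs once, and a + 1 occurs j times.  If j ≥ 1 then a + 1 is the second
-- smallest part.  If j = 0 then a + 1 does not occur; in all cases the
-- generating function is Σ_{a ≥ 1} q^(a + j(a+1)) (-q^(a+2);q)_∞.

Doubled : ℕ → List ℕ → Set
Doubled j []        = ⊥
Doubled j p@(a ∷ _) = mult (suc a) p ≡ j × DistinctExcept (suc a) p

doubled? : ∀ j → Decidable (Doubled j)
doubled? j []        = no λ ()
doubled? j p@(a ∷ _) = mult (suc a) p ≟ j ×-dec distinctExcept? (suc a) p

IsP″ : ℕ → ℕ → List ℕ → Set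
IsP″ j n p = Partition n p × Doubled j p

isP″? : ∀ j n → Decidable (IsP″ j n)
isP″? j n p = partition? n p ×-dec doubled? j p

P″ : ℕ → ℕ → ℕ
P″ j n = number (isP″? j n) n n

SmallestRepeated : ℕ → List ℕ → Set
SmallestRepeated k []        = ⊥
SmallestRepeated k p@(a ∷ _) = mult a p ≡ k × DistinctExcept a p

smallestRepeated? : ∀ k → Decidable (SmallestRepeated k)
smallestRepeated? k []        = no λ ()
smallestRepeated? k p@(a ∷ _) = mult a p ≟ k ×-dec distinctExcept? a p

IsD : ℕ → ℕ → List ℕ → Set
IsD k n p = WeakPartition n p × SmallestRepeated k p

isD? : ∀ k n → Decidable (IsD k n)
isD? k n p = weakPartition? n p ×-dec smallestRepeated? k p

-- Up to k zeros may occur in addition to at most n positive parts.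

D : ℕ → ℕ → ℕ
D k n = number (isD? k n) (k + n) n

A : ℕ → ℕ → ℚ
A k n = ½ ℚ.* fromℕ (P₁ n + P′ (k ∸ 1) n + P₂ n + P″ (k ∸ 1) n)

words-unique : ∀ {as} → Unique as → ∀ L → Unique (words as L)
words-unique u zero    = [] ∷ []
words-unique {as} u (suc L) =
  All.tabulate []≢ ∷ Unique.cartesianProductWith⁺ _∷_ ∷-injective u (words-unique u L)
  where
  []≢ : ∀ {p} → p ∈ cartesianProductWith _∷_ as (words as L) → [] ≢ p
  []≢ p∈ refl with ∈-cartesianProductWith⁻ _∷_ as (words as L) p∈
  ... | _ , _ , _ , _ , ()

words-complete : ∀ {as} L {p} → length p ≤ L → All (_∈ as) p → p ∈ words as L
words-complete zero    {[]}    _         _        = here refl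
words-complete (suc L) {[]}    _         _        = here refl
words-complete (suc L) {_ ∷ _} (s≤s l≤L) (a∈ ∷ p∈) =
  there (∈-cartesianProductWith⁺ _∷_ a∈ (words-complete L l≤L p∈))

parts-bounded : ∀ p → All (_≤ sum p) p
parts-bounded []      = []
parts-bounded (a ∷ p) =
  m≤m+n a (sum p) ∷ All.map (λ b≤ → ≤-trans b≤ (m≤n+m (sum p) a)) (parts-bounded p)

parts∈upTo : ∀ {n p} → WeakPartition n p → All (_∈ upTo (suc n)) p
parts∈upTo {p = p} (weakPartition _ refl) =
  All.map (λ b≤ → ∈-upTo⁺ (s≤s b≤)) (parts-bounded p)

length≤zeros+sum : ∀ p → length p ≤ mult 0 p + sum p
length≤zeros+sum []          = z≤n
length≤zeros+sum (zero ∷ p)  = s≤s (length≤zeros+sum p)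
length≤zeros+sum (suc a ∷ p) = begin
  suc (length p)               ≤⟨ s≤s (length≤zeros+sum p) ⟩
  suc (mult 0 p + sum p)       ≡⟨ +-suc (mult 0 p) (sum p) ⟨
  mult 0 p + suc (sum p)       ≤⟨ +-monoʳ-≤ (mult 0 p) (s≤s (m≤n+m (sum p) a)) ⟩
  mult 0 p + (suc a + sum p)   ∎
  where open ≤-Reasoning

positive⇒noZeros : ∀ {p} → Positive p → mult 0 p ≡ 0
positive⇒noZeros pos = cong length (filter-none (0 ≟_) (All.map (λ { (s≤s _) () }) pos))

sorted⇒positive : ∀ {a p} → Linked _≤_ (suc a ∷ p) → Positive (suc a ∷ p)
sorted⇒positive [-]               = s≤s z≤n ∷ []
sorted⇒positive (s≤s a≤b ∷ sorted) = s≤s z≤n ∷ sorted⇒positive sorted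

partition-complete : ∀ {n p} → Partition n p → p ∈ words (upTo (suc n)) n
partition-complete {n} {p} (w@(weakPartition _ refl) , pos) =
  words-complete n
    (subst (λ z → length p ≤ z + sum p) (positive⇒noZeros pos) (length≤zeros+sum p))
    (parts∈upTo w)

D-complete : ∀ {k n p} → IsD k n p → p ∈ words (upTo (suc n)) (k + n)
D-complete {k} {p = p} (w@(weakPartition sorted refl) , r) =
  words-complete (k + sum p)
    (≤-trans (length≤zeros+sum p) (+-monoˡ-≤ (sum p) (zeros≤k p sorted r)))
    (parts∈upTo w)
  where
  zeros≤k : ∀ p → Linked _≤_ p → SmallestRepeated k p → mult 0 p ≤ k
  zeros≤k (zero ∷ p)  _ (m , _) = ≤-reflexive m
  zeros≤k (suc a ∷ p) s _ = subst (_≤ k) (sym (positive⇒noZeros (sorted⇒positive s))) z≤n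

{-# OPTIONS --safe #-}

-- Decreasing one copy of the smallest part by one maps the positive partitions
-- of n + 1 counted by D_k bijectively onto the partitions of n counted by
-- P'_{k-1} (if that part was 1, so that the copy disappears) and by P''_{k-1}
-- (otherwise).  If the smallest part is 0, deleting the k zeros leaves a partition
-- of n + 1 into distinct positive parts, and decreasing its smallest part gives
-- the partitions counted by P_1 (a part 1 disappears) and by P_2 (a gap of at
-- least 2 opens up).

module Submission where

open import Defs
open import Data.List using (List; []; _∷_; _++_; length; map; filter; replicate; upTo)
open import Data.List.Membership.Propositional using (_∈_)
open import Data.List.Membership.Propositional.Properties
  using (∈-filter⁺; ∈-filter⁻; ∈-map⁺; ∈-map⁻; ∈-++⁺ˡ; ∈-++⁺ʳ; ∈-++⁻)
open import Data.List.Membership.Propositional.Properties.WithK using (unique∧set⇒bag)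
open import Data.List.Properties
  using (∷-injectiveʳ; ++-cancelˡ; length-++; length-map; filter-accept; filter-reject; filter-all)
open import Data.List.Relation.Binary.BagAndSetEquality using (∼bag⇒↭)
open import Data.List.Relation.Binary.Permutation.Propositional.Properties using (↭-length)
open import Data.List.Relation.Unary.All as All using (All; []; _∷_)
open import Data.List.Relation.Unary.All.Properties using (filter⁺)
open import Data.List.Relation.Unary.AllPairs using ([]; _∷_)
open import Data.List.Relation.Unary.Linked using (Linked; []; [-]; _∷_; tail)
open import Data.List.Relation.Unary.Linked.Properties using (Linked⇒All)
open import Data.List.Relation.Unary.Unique.Propositional using (Unique)
import Data.List.Relation.Unary.Unique.Propositional.Properties as Unique
open import Data.Maybe.Relation.Unary.All using (just; nothing)
open import Data.Nat using (ℕ; zero; suc; _+_; _∸_; _≤_; _<_; z≤n; s≤s; _≟_)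
open import Data.Nat.ListAction using (sum)
open import Data.Nat.Properties
  using ( ≤-refl; ≤-trans; <-≤-trans; <⇒≤; <⇒≢; ≤∧≢⇒<; 1+n≢n; suc-injective; +-comm
        ; ∸-monoˡ-≤; m+n∸n≡m; m∸n+n≡m; +-monoˡ-≤)
open import Data.Nat.Solver using (module +-*-Solver)
open import Data.Product using (_×_; _,_; proj₁; proj₂; ∃)
open import Data.Rational using (½; _*_)
open import Data.Sum using (_⊎_; inj₁; inj₂)
open import Data.Unit using (tt)
open import Function using (_∘_; _⇔_; mk⇔; module Equivalence)
open import Relation.Binary.PropositionalEquality
  using (_≡_; _≢_; refl; sym; trans; cong; cong₂; subst; module ≡-Reasoning)
open import Relation.Nullary using (¬_)
open import Relation.Nullary.Decidable using (¬?)
open import Relation.Unary using (Decidable)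

open Equivalence using (to; from)

-- Counting the elements that satisfy a predicate.

record HasSize {X : Set} (P : X → Set) (m : ℕ) : Set where
  field
    elements : List X
    unique   : Unique elements
    sound    : ∀ {x} → x ∈ elements → P x
    complete : ∀ {x} → P x → x ∈ elements
    size     : length elements ≡ m

open HasSize

module _ {X : Set} {P : X → Set} where

  -- Membership concerns `x` alone, so it does not matter whether `P x` has several proofs. Two
  -- duplicate-free lists with the same members are equal as bags, hence permutations of each other.
  size-unique : ∀ {m n} → HasSize P m → HasSize P n → m ≡ n
  size-unique c d = trans (sym (size c)) (trans
    (↭-length (∼bag⇒↭ (unique∧set⇒bag (unique c) (unique d)
      (mk⇔ (complete d ∘ sound c) (complete c ∘ sound d)))))
    (size d))

  -- The last hypothesis on P says P ⊆ f(Q) ∪ g(R), with the union replaced by an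
  -- arbitrary list containing both images.
  disjoint-images-size :
    ∀ {Y Z : Set} {Q : Y → Set} {R : Z → Set} {f : Y → X} {g : Z → X} {m n} →
    (∀ {y y′} → f y ≡ f y′ → y ≡ y′) → (∀ {z z′} → g z ≡ g z′ → z ≡ z′) →
    (∀ {y z} → R z → f y ≢ g z) →
    (∀ {y} → Q y → P (f y)) → (∀ {z} → R z → P (g z)) →
    (∀ {xs} → (∀ {y} → Q y → f y ∈ xs) → (∀ {z} → R z → g z ∈ xs) → ∀ {x} → P x → x ∈ xs) →
    HasSize Q m → HasSize R n → HasSize P (m + n)
  disjoint-images-size {f = f} {g} f-inj g-inj disjoint f-sound g-sound cover c d = record
    { elements = map f ys ++ map g zs
    ; unique   = Unique.++⁺ (Unique.map⁺ f-inj (unique c)) (Unique.map⁺ g-inj (unique d)) apart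
    ; sound    = λ x∈ → image-sound (∈-++⁻ (map f ys) x∈)
    ; complete = cover (λ q → ∈-++⁺ˡ (∈-map⁺ f (complete c q)))
                       (λ r → ∈-++⁺ʳ (map f ys) (∈-map⁺ g (complete d r)))
    ; size     = trans (length-++ (map f ys))
                   (cong₂ _+_ (trans (length-map f ys) (size c)) (trans (length-map g zs) (size d)))
    }
    where
    ys = elements c
    zs = elements d

    apart : ∀ {x} → ¬ (x ∈ map f ys × x ∈ map g zs)
    apart (x∈f , x∈g) with ∈-map⁻ f x∈f | ∈-map⁻ g x∈g
    ... | y , _ , refl | z , z∈ , fy≡gz = disjoint (sound d z∈) fy≡gz

    image-sound : ∀ {x} → x ∈ map f ys ⊎ x ∈ map g zs → P x
    image-sound (inj₁ x∈) with ∈-map⁻ f x∈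
    ... | y , y∈ , refl = f-sound (sound c y∈)
    image-sound (inj₂ x∈) with ∈-map⁻ g x∈
    ... | z , z∈ , refl = g-sound (sound d z∈)

number-size : ∀ {P : List ℕ → Set} (P? : Decidable P) L n →
  (∀ {p} → P p → p ∈ words (upTo (suc n)) L) → HasSize P (number P? L n)
number-size P? L n inWords = record
  { elements = filter P? ws
  ; unique   = Unique.filter⁺ P? (words-unique (Unique.upTo⁺ (suc n)) L)
  ; sound    = λ p∈ → proj₂ (∈-filter⁻ P? {xs = ws} p∈)
  ; complete = λ Pp → ∈-filter⁺ P? (inWords Pp) Pp
  ; size     = refl
  }
  where ws = words (upTo (suc n)) L

-- Lowering the smallest part by one.

incrementHead : List ℕ → List ℕ
-- A default that keeps the map total and injective; below it is applied only to lists with a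
-- positive head.
incrementHead []      = []
incrementHead (a ∷ p) = suc a ∷ p

incrementHead-injective : ∀ {p q} → incrementHead p ≡ incrementHead q → p ≡ q
incrementHead-injective {[]}    {[]}    refl = refl
incrementHead-injective {_ ∷ _} {_ ∷ _} refl = refl

data PositiveHead : List ℕ → Set where
  positiveHead : ∀ {a p} → PositiveHead (suc a ∷ p)

-- The bijection is run backwards: `1 ∷_` and `incrementHead` are injective on all lists, while
-- lowering needs a positive head. The heads of the two images are 1 and at least 2, which separates
-- them. This serves both the distinct partitions and the lists of `IsD` with positive head.
decrement-head-size : ∀ {P Q R : List ℕ → Set} {m n} →
  (∀ {p} → P p → PositiveHead p) → (∀ {p} → R p → PositiveHead p) →
  (∀ {p} → P (1 ∷ p) ⇔ Q p) →
  (∀ {a p} → P (suc (suc a) ∷ p) ⇔ R (suc a ∷ p)) →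
  HasSize Q m → HasSize R n → HasSize P (m + n)
decrement-head-size {P} {Q} {R} headᴾ headᴿ P⇔Q P⇔R =
  disjoint-images-size ∷-injectiveʳ incrementHead-injective disjoint (from P⇔Q) increment cover
  where
  disjoint : ∀ {p q} → R q → 1 ∷ p ≢ incrementHead q
  disjoint r eq with positiveHead ← headᴿ r | () ← eq

  increment : ∀ {p} → R p → P (incrementHead p)
  increment r with positiveHead ← headᴿ r = from P⇔R r

  cover : ∀ {xs} → (∀ {p} → Q p → 1 ∷ p ∈ xs) → (∀ {p} → R p → incrementHead p ∈ xs) →
          ∀ {p} → P p → p ∈ xs
  cover fromQ fromR {p} Pp with headᴾ Pp
  ... | positiveHead {zero}  = fromQ (to P⇔Q Pp)
  ... | positiveHead {suc a} = fromR (to P⇔R Pp)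

-- Conditions on the first entries of a sorted list as bounds on all entries.

linked⇒above : ∀ {a p} → Linked _≤_ (a ∷ p) → All (a ≤_) p
linked⇒above [-]       = []
linked⇒above (a≤b ∷ s) = Linked⇒All ≤-trans a≤b s

above⇒linked : ∀ {a p} → All (a ≤_) p → Linked _≤_ p → Linked _≤_ (a ∷ p)
above⇒linked []        _ = [-]
above⇒linked (a≤b ∷ _) s = a≤b ∷ s

above∧∉⇒strictlyAbove : ∀ {a p} → All (a ≤_) p → All (a ≢_) p → All (a <_) p
above∧∉⇒strictlyAbove a≤ a≢ = All.zipWith (λ (≤b , ≢b) → ≤∧≢⇒< ≤b ≢b) (a≤ , a≢)

smallestExceeds1⇔ : ∀ {p} → Linked _≤_ p → SmallestExceeds1 p ⇔ All (1 <_) p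
smallestExceeds1⇔ {[]}    _ = mk⇔ (λ _ → []) (λ _ → nothing)
smallestExceeds1⇔ {a ∷ p} s = mk⇔
  (λ { (just 1<a) → 1<a ∷ All.map (<-≤-trans 1<a) (linked⇒above s) })
  (λ { (1<a ∷ _) → just 1<a })

-- The bound treats empty and nonempty tails alike, and by sortedness it need only be checked at the
-- first entry. Sortedness also keeps `b ∸ a` from being truncated.
gap≥2⇔ : ∀ {a p} → Linked _≤_ (a ∷ p) → Gap≥2 (a ∷ p) ⇔ All (suc a <_) p
gap≥2⇔ [-] = mk⇔ (λ _ → []) (λ _ → tt)
gap≥2⇔ {a} (_∷_ {y = b} a≤b s) = mk⇔
  (λ 2≤b∸a → Linked⇒All ≤-trans (subst (2 + a ≤_) (m∸n+n≡m a≤b) (+-monoˡ-≤ a 2≤b∸a)) s)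
  (λ { (2+a≤b ∷ _) → subst (_≤ b ∸ a) (m+n∸n≡m 2 a) (∸-monoˡ-≤ a 2+a≤b) })

-- Partitions into distinct parts.

DistinctPartition : ℕ → List ℕ → Set
DistinctPartition n p = Partition n p × Distinct p

-- For positive parts, being distinct from the deleted 1 is the bound required by `IsP₁`. If 1 was
-- the only part, the empty partition remains, which `P₁` counts.
distinct-1∷⇔ : ∀ {n p} → DistinctPartition (suc n) (1 ∷ p) ⇔ IsP₁ n p
distinct-1∷⇔ = mk⇔
  (λ { ((weakPartition s e , _ ∷ pos) , 1∉ ∷ u) →
       (weakPartition (tail s) (suc-injective e) , pos) , u ,
       from (smallestExceeds1⇔ (tail s)) (above∧∉⇒strictlyAbove pos 1∉) })
  (λ { ((weakPartition s e , pos) , u , >1) →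
       (weakPartition (above⇒linked pos s) (cong suc e) , ≤-refl ∷ pos) ,
       All.map <⇒≢ (to (smallestExceeds1⇔ s) >1) ∷ u })

-- Both sides amount to the tail lying strictly above `suc (suc a)`: on the left by distinctness
-- from the head, on the right by the gap over the lowered head.
distinct-2+∷⇔ : ∀ {n a p} →
  DistinctPartition (suc n) (suc (suc a) ∷ p) ⇔ IsP₂ n (suc a ∷ p)
distinct-2+∷⇔ = mk⇔
  (λ { ((weakPartition s e , _ ∷ pos) , 2+a∉ ∷ u) →
       let above  = above∧∉⇒strictlyAbove (linked⇒above s) 2+a∉
           1+a<   = All.map <⇒≤ above
           sorted = above⇒linked (All.map <⇒≤ 1+a<) (tail s)
       in (weakPartition sorted (suc-injective e) , s≤s z≤n ∷ pos) ,
          All.map <⇒≢ 1+a< ∷ u , from (gap≥2⇔ sorted) above })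
  (λ { ((weakPartition s e , _ ∷ pos) , _ ∷ u , gap) →
       let above = to (gap≥2⇔ s) gap
       in (weakPartition (above⇒linked (All.map <⇒≤ above) (tail s)) (cong suc e) ,
           s≤s z≤n ∷ pos) ,
          All.map <⇒≢ above ∷ u })

-- Distinctness with one exempt value.

DistinctApartFrom : ℕ → ℕ → List ℕ → Set
DistinctApartFrom c j p = mult c p ≡ j × DistinctExcept c p

-- The filter drops a copy of the exempt value, so only the multiplicity notices it. This is the
-- passage from `k` to `k ∸ 1`.
apartFrom-∷⇔ : ∀ c p {j} → DistinctApartFrom c (suc j) (c ∷ p) ⇔ DistinctApartFrom c j p
apartFrom-∷⇔ c p
  rewrite filter-accept (c ≟_) {xs = p} refl
        | filter-reject (λ b → ¬? (c ≟ b)) {xs = p} (λ c≢c → c≢c refl)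
  = mk⇔ (λ (m , u) → suc-injective m , u) (λ (m , u) → cong suc m , u)

-- The head `a` differs from the exempt `suc a` and survives the filter, so distinctness there
-- forbids a second copy of `a`.
apartFrom-suc-∷⇔ : ∀ a p {j} → All (a ≤_) p →
  DistinctApartFrom (suc a) j (a ∷ p) ⇔ (All (a <_) p × DistinctApartFrom (suc a) j p)
apartFrom-suc-∷⇔ a p a≤
  rewrite filter-reject (suc a ≟_) {xs = p} 1+n≢n
        | filter-accept (λ b → ¬? (suc a ≟ b)) {xs = p} 1+n≢n
  = mk⇔ (λ { (m , a∉ ∷ u) → above∧∉⇒strictlyAbove a≤ (All.tabulate (a≢ a∉)) , m , u })
        (λ (a< , m , u) → m , filter⁺ (λ b → ¬? (suc a ≟ b)) (All.map <⇒≢ a<) ∷ u)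
  where
  a≢ : All (a ≢_) (filter (λ b → ¬? (suc a ≟ b)) p) → ∀ {b} → b ∈ p → a ≢ b
  a≢ a∉ b∈ refl = All.lookup a∉ (∈-filter⁺ (λ b → ¬? (suc a ≟ b)) b∈ 1+n≢n) refl

D-1∷⇔ : ∀ {j n p} → IsD (suc j) (suc n) (1 ∷ p) ⇔ IsP′ j n p
D-1∷⇔ {p = p} = mk⇔
  (λ { (weakPartition s e , r) →
       (weakPartition (tail s) (suc-injective e) , linked⇒above s) , to (apartFrom-∷⇔ 1 p) r })
  (λ { ((weakPartition s e , pos) , r) →
       weakPartition (above⇒linked pos s) (cong suc e) , from (apartFrom-∷⇔ 1 p) r })

-- The exempt value is `2 + a` on both sides: the smallest part before lowering, one more than the
-- smallest part afterwards. Lowering one copy leaves `j` of them, none if `j` is 0.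
D-2+∷⇔ : ∀ {j n a p} → IsD (suc j) (suc n) (suc (suc a) ∷ p) ⇔ IsP″ j n (suc a ∷ p)
D-2+∷⇔ {a = a} {p} = mk⇔
  (λ { (weakPartition s e , r) →
       let above  = linked⇒above s
           sorted = above⇒linked (All.map <⇒≤ above) (tail s)
       in (weakPartition sorted (suc-injective e) , sorted⇒positive sorted) ,
          from (apartFrom-suc-∷⇔ (suc a) p (All.map <⇒≤ above))
            (above , to (apartFrom-∷⇔ (2 + a) p) r) })
  (λ { ((weakPartition s e , _) , r) →
       let above , r′ = to (apartFrom-suc-∷⇔ (suc a) p (linked⇒above s)) r
       in weakPartition (above⇒linked above (tail s)) (cong suc e) ,
          from (apartFrom-∷⇔ (2 + a) p) r′ })

-- Smallest part 0: a block of zeros in front of a distinct partition.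

split-zeros : ∀ {p} → Linked _≤_ p → DistinctExcept 0 p →
  ∃ λ q → p ≡ replicate (mult 0 p) 0 ++ q × DistinctPartition (sum p) q
split-zeros {[]} _ _ = [] , refl , (weakPartition [] refl , []) , []
split-zeros {zero ∷ p} s u with split-zeros (tail s) u
... | q , p≡ , d = q , cong (0 ∷_) p≡ , d
-- By sortedness no zero follows a positive entry, so the multiplicity is 0 and the filter keeps
-- everything.
split-zeros {suc a ∷ p} s u =
  suc a ∷ p ,
  cong (λ j → replicate j 0 ++ suc a ∷ p) (sym (positive⇒noZeros pos)) ,
  (weakPartition s refl , pos) ,
  subst Distinct (filter-all (λ b → ¬? (0 ≟ b)) (All.map <⇒≢ pos)) u
  where pos = sorted⇒positive s

prepend-zeros : ∀ j {n q} → DistinctPartition n q →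
  WeakPartition n (replicate j 0 ++ q) × DistinctApartFrom 0 j (replicate j 0 ++ q)
prepend-zeros zero ((w , pos) , u) =
  w , positive⇒noZeros pos ,
  subst Distinct (sym (filter-all (λ b → ¬? (0 ≟ b)) (All.map <⇒≢ pos))) u
prepend-zeros (suc j) d with prepend-zeros j d
... | weakPartition s e , m , u =
  weakPartition (above⇒linked (All.tabulate λ _ → z≤n) s) e , cong suc m , u

D-size : ∀ {j n l m} →
  HasSize (DistinctPartition (suc n)) l →
  HasSize (λ p → IsD (suc j) (suc n) p × PositiveHead p) m →
  HasSize (IsD (suc j) (suc n)) (l + m)
D-size {j} {n} =
  -- Prepending is injective because the number of zeros is fixed. That number, `suc j`, is
  -- positive, so the head is 0: the image avoids the lists with positive head, and
  -- `SmallestRepeated` reduces to `DistinctApartFrom 0`.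
  disjoint-images-size (++-cancelˡ (replicate (suc j) 0) _ _) (λ eq → eq)
    (λ { (_ , positiveHead) () }) (prepend-zeros (suc j)) proj₁ cover
  where
  cover : ∀ {xs} → (∀ {q} → DistinctPartition (suc n) q → replicate (suc j) 0 ++ q ∈ xs) →
          (∀ {p} → IsD (suc j) (suc n) p × PositiveHead p → p ∈ xs) →
          ∀ {p} → IsD (suc j) (suc n) p → p ∈ xs
  cover fromZeros fromPositive {suc a ∷ p} d = fromPositive (d , positiveHead)
  cover {xs} fromZeros fromPositive {zero ∷ p} (weakPartition s e , m , u)
    with split-zeros s u
  ... | q , p≡ , d = subst (_∈ xs) (sym (trans p≡ (cong (λ i → replicate i 0 ++ q) m)))
                       (fromZeros (subst (λ i → DistinctPartition i q) e d))

-- Combining the four counts.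

D-suc : ∀ j n → D (suc j) (suc n) ≡ (P₁ n + P₂ n) + (P′ j n + P″ j n)
D-suc j n = size-unique
  (number-size (isD? (suc j) (suc n)) (suc j + suc n) (suc n) D-complete)
  (D-size distinct positive)
  where
  partitions-size : ∀ {Q : List ℕ → Set} (Q? : Decidable (λ p → Partition n p × Q p)) →
    HasSize (λ p → Partition n p × Q p) (number Q? n n)
  partitions-size Q? = number-size Q? n n (partition-complete ∘ proj₁)

  distinct : HasSize (DistinctPartition (suc n)) (P₁ n + P₂ n)
  distinct = decrement-head-size
    (λ { {suc _ ∷ _} _ → positiveHead
       -- The sum `suc n` is nonzero, so there is a smallest part to lower.
       ; {[]} ((weakPartition _ () , _) , _)
       ; {zero ∷ _} ((_ , () ∷ _) , _) })
    (λ { {suc _ ∷ _} _ → positiveHead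
       -- `Gap≥2 []` is `⊥`, so for `n` equal to 0 the empty partition is counted by `P₁` and not
       -- again by `P₂`.
       ; {[]} (_ , _ , ())
       ; {zero ∷ _} ((_ , () ∷ _) , _) })
    distinct-1∷⇔ distinct-2+∷⇔ (partitions-size (isP₁? n)) (partitions-size (isP₂? n))

  positive : HasSize (λ p → IsD (suc j) (suc n) p × PositiveHead p) (P′ j n + P″ j n)
  positive = decrement-head-size proj₂
    (λ { {suc _ ∷ _} _ → positiveHead
       ; {[]} (_ , ())
       ; {zero ∷ _} ((_ , () ∷ _) , _) })
    (mk⇔ (to D-1∷⇔ ∘ proj₁) (λ d → from D-1∷⇔ d , positiveHead))
    (mk⇔ (to D-2+∷⇔ ∘ proj₁) (λ d → from D-2+∷⇔ d , positiveHead))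
    (partitions-size (isP′? j n)) (partitions-size (isP″? j n))

theorem4 : (k n : ℕ) → 1 ≤ k → A k n ≡ ½ * fromℕ (D k (n + 1))
theorem4 (suc j) n _ = cong (λ m → ½ * fromℕ m) (begin
  P₁ n + P′ j n + P₂ n + P″ j n     ≡⟨ rearrange (P₁ n) (P′ j n) (P₂ n) (P″ j n) ⟩
  (P₁ n + P₂ n) + (P′ j n + P″ j n) ≡⟨ D-suc j n ⟨
  D (suc j) (suc n)                 ≡⟨ cong (D (suc j)) (+-comm n 1) ⟨
  D (suc j) (n + 1)                 ∎)
  where
  open ≡-Reasoning
  open +-*-Solver

  rearrange : ∀ a b c d → a + b + c + d ≡ (a + c) + (b + d)
  rearrange = solve 4 (λ a b c d → a :+ b :+ c :+ d := (a :+ c) :+ (b :+ d)) refl
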